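{- Let $n$ and $d$ be positive integers and let $\vec{G}$ be a digraph of order $n$ whose minimum outdegree is at least $d$. Then $\vec{G}$ contains a subdivision of the complete digraph of order $\lfloor d^2/(8n^{3/2}) \rfloor$.
   Context: Digraphs have no loops, and for any ordered pair of vertices $x,y$ there is at most one edge directed from $x$ to $y$ (there may also be an edge from $y$ to $x$). The complete digraph of order $\ell$ has $\ell$ vertices and, for every ordered pair $(v,w)$ of distinct vertices, an edge directed from $v$ to $w$. A digraph $\vec{H}$ is a subdivision of a digraph $\vec{F}$ if $\vec{H}$ can be obtained from $\vec{F}$ by replacing each edge $\vec{xy}$ of $\vec{F}$ by a directed path from $x$ to $y$, such that the paths corresponding to distinct edges are internally vertex-disjoint (and their interior vertices are new). "Contains a subdivision" means has a subdigraph that is a subdivision. -}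

module Defs where

open import Data.Fin using (Fin; toℕ)
open import Data.List using (allFin; filter; length; map)
open import Data.List.Extrema.Nat using (min)
open import Data.Nat using (ℕ; zero; suc; _*_; _^_; _≤_; _≤?_; z≤n; NonZero)
open import Data.Nat.Properties
open import Data.Product using (Σ-syntax; _×_; _,_)
open import Function.Bundles using (_↣_; _↔_; _⇔_; module Injection; module Inverse)
open import Level using (0ℓ)
open import Relation.Binary using (Rel; Decidable)
open import Relation.Binary.PropositionalEquality using (_≡_; _≢_; refl; sym)
open import Relation.Nullary using (¬_; yes; no)

record Digraph (V : Set) : Set₁ where
  field
    Edge     : Rel V 0ℓ
    loopless : ∀ {v} → ¬ Edge v v

open Digraph public

complete : ∀ ℓ → Digraph (Fin ℓ)
complete ℓ = record { Edge = _≢_ ; loopless = λ v≢v → v≢v refl }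

-- Edges are a relation, so counting outneighbours needs it to be decidable.
outdegree : ∀ {n} (G : Digraph (Fin n)) → Decidable (Edge G) → Fin n → ℕ
outdegree {n} G edge? v = length (filter (edge? v) (allFin n))

-- Outdegrees are at most n, so for n > 0 the default value n of the
-- list minimum does not affect the result.
minOutdegree : ∀ {n} (G : Digraph (Fin n)) → Decidable (Edge G) → ℕ
minOutdegree {n} G edge? = min n (map (outdegree G edge?) (allFin n))

-- H is, up to isomorphism, a subdigraph of G.
record _⊑_ {W V : Set} (H : Digraph W) (G : Digraph V) : Set where
  field
    vertices : W ↣ V
  open Injection vertices using (to)
  field
    edges : ∀ {x y} → Edge H x y → Edge G (to x) (to y)

record _≅_ {W V : Set} (H : Digraph W) (G : Digraph V) : Set where
  field
    vertices : W ↔ V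
  open Inverse vertices using (to)
  field
    edges : ∀ {x y} → Edge H x y ⇔ Edge G (to x) (to y)

-- Replacing every edge xy of F by a path from x to y with k x y new interior
-- vertices, inner x y 0 , … , inner x y (k x y - 1) in order.  (Values of k at
-- non-edges play no role.)  The edge proof carried by inner is irrelevant,
-- so that each ordered pair xy contributes only one path.
module Subdivide {V : Set} (F : Digraph V) (k : V → V → ℕ) where

  data Vertex : Set where
    branch : V → Vertex
    inner  : ∀ x y → .(Edge F x y) → Fin (k x y) → Vertex

  data Step : Rel Vertex 0ℓ where
    direct : ∀ {x y} → Edge F x y → k x y ≡ 0 →
             Step (branch x) (branch y)
    first  : ∀ {x y} .{e : Edge F x y} {i} → toℕ i ≡ 0 →
             Step (branch x) (inner x y e i)
    next   : ∀ {x y} .{e : Edge F x y} {i j} → toℕ j ≡ suc (toℕ i) →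
             Step (inner x y e i) (inner x y e j)
    last   : ∀ {x y} .{e : Edge F x y} {i} → suc (toℕ i) ≡ k x y →
             Step (inner x y e i) (branch y)

  step-loopless : ∀ {v} → ¬ Step v v
  step-loopless (direct e _) = loopless F e
  step-loopless (next j≡1+j) = 1+n≢n (sym j≡1+j)

  digraph : Digraph Vertex
  digraph = record { Edge = Step ; loopless = step-loopless }

IsSubdivisionOf : ∀ {W V : Set} → Digraph W → Digraph V → Set
IsSubdivisionOf {V = V} H F = Σ[ k ∈ (V → V → ℕ) ] H ≅ Subdivide.digraph F k

ContainsSubdivisionOf : ∀ {U V : Set} → Digraph U → Digraph V → Set₁
ContainsSubdivisionOf G F =
  Σ[ W ∈ Set ] Σ[ H ∈ Digraph W ] H ⊑ G × IsSubdivisionOf H F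

-- ℓ ≤ d² / (8 n^{3/2}), with denominators cleared and both sides squared.
_≤d²/8n^3/2[_,_] : ℕ → ℕ → ℕ → Set
ℓ ≤d²/8n^3/2[ d , n ] = 64 * n ^ 3 * ℓ ^ 2 ≤ d ^ 4

greatestBelow : ℕ → ℕ → ℕ → ℕ
greatestBelow d n zero = zero
greatestBelow d n (suc b) with 64 * n ^ 3 * suc b ^ 2 ≤? d ^ 4
... | yes _ = suc b
... | no  _ = greatestBelow d n b

-- ⌊ d² / (8 n^{3/2}) ⌋ for n > 0, as the greatest natural number ℓ with
-- ℓ ≤ d² / (8 n^{3/2}); the search may start at d ^ 4.
⌊d²/8n^3/2⌋ : ℕ → ℕ → ℕ
⌊d²/8n^3/2⌋ d n = greatestBelow d n (d ^ 4)

private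
  below : ∀ d n b → greatestBelow d n b ≤d²/8n^3/2[ d , n ]
  below d n zero rewrite *-zeroʳ (64 * n ^ 3) = z≤n
  below d n (suc b) with 64 * n ^ 3 * suc b ^ 2 ≤? d ^ 4
  ... | yes p = p
  ... | no  _ = below d n b

  above : ∀ d n b → ¬ suc b ≤d²/8n^3/2[ d , n ] →
          ¬ suc (greatestBelow d n b) ≤d²/8n^3/2[ d , n ]
  above d n zero ¬p = ¬p
  above d n (suc b) ¬p with 64 * n ^ 3 * suc b ^ 2 ≤? d ^ 4
  ... | yes _ = ¬p
  ... | no ¬q = above d n b ¬q

  start : ∀ d n .{{_ : NonZero n}} → ¬ suc (d ^ 4) ≤d²/8n^3/2[ d , n ]
  start d n p = <⇒≱ (n<1+n (d ^ 4)) (begin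
    m                    ≤⟨ m≤m*n m (m ^ 1) {{m^n≢0 m 1}} ⟩
    m ^ 2                ≤⟨ m≤n*m (m ^ 2) (64 * n ^ 3) {{m*n≢0 64 (n ^ 3) {{_}} {{m^n≢0 n 3}}}} ⟩
    64 * n ^ 3 * m ^ 2   ≤⟨ p ⟩
    d ^ 4                ∎)
    where open ≤-Reasoning
          m = suc (d ^ 4)

-- ⌊d²/8n^3/2⌋ d n = ℓ satisfies ℓ ≤ d² / (8 n^{3/2}) < ℓ + 1.
⌊d²/8n^3/2⌋-spec : ∀ d n .{{_ : NonZero n}} → let ℓ = ⌊d²/8n^3/2⌋ d n in
  ℓ ≤d²/8n^3/2[ d , n ] × ¬ suc ℓ ≤d²/8n^3/2[ d , n ]
⌊d²/8n^3/2⌋-spec d n = below d n (d ^ 4) , above d n (d ^ 4) (start d n)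

{-# OPTIONS --safe #-}

-- Choose a nonempty vertex set A minimising d ∣A∣ + 2n ∣∂A∣, where ∂A is the
-- set of outneighbours of A outside A.  Inside A all outdegrees are at least
-- d/2, and every nonempty B ⊆ A satisfies d (∣A∣ − ∣B∣) ≤ 2n ∣N⁺(B) ∩ A ∖ B∣.
-- By double counting, ℓ vertices of A have indegree at least d/2 − ℓ inside A;
-- these are the branch vertices.  Let X be a set of forbidden vertices with
-- 8n ∣X∣ + 4dℓ ≤ d².  A breadth-first search in A ∖ X from one branch vertex
-- gains at least d²/8n vertices per layer until it meets the inneighbourhood
-- of another, so it gives a path with T = O(n²/d²) interior vertices.
-- As 64 n³ℓ² ≤ d⁴, ℓ² such paths use so few vertices that all of them can be
-- chosen greedily, X being the vertices used so far.

module Submission where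

open import Defs
open import Data.Bool using (true; false; if_then_else_)
open import Data.Fin using (Fin; zero; suc; toℕ; combine; remQuot; fromℕ<)
open import Data.Fin.Properties using (any?; suc-injective; combine-injective; remQuot-combine)
open import Data.Fin.Subset
  using (Subset; inside; outside; _∈_; _∉_; _⊆_; ∣_∣; _∪_; ⁅_⁆; ⊤; ⊥; ⋃; Nonempty)
open import Data.Fin.Subset.Properties
  using (_∈?_; nonempty?; anySubset?; ∈⊤; ∣p∣≤n; ∣⊥∣≡0; ∣⁅x⁆∣≡1; x∈⁅x⁆; x∈⁅y⁆⇒x≡y;
         p⊆q⇒∣p∣≤∣q∣; x∈p∪q⁻; x∈p∪q⁺)
open import Data.List as List using (List; []; _∷_; [_]; _++_; length; lookup; filter)
open import Data.List.Extrema.Nat using (min≤xs)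
import Data.List.Membership.Propositional as List∈
open import Data.List.Membership.Propositional.Properties
  using (∈-lookup; ∈-allFin; ∈-map⁺; ∈-tabulate⁺)
open import Data.List.Properties using (length-++; length-tabulate)
open import Data.List.Relation.Unary.All as All using (All; []; _∷_)
import Data.List.Relation.Unary.All.Properties as All
open import Data.List.Relation.Unary.AllPairs using ([]; _∷_)
import Data.List.Relation.Unary.Any as Any
open import Data.List.Relation.Unary.Unique.Propositional using (Unique)
import Data.List.Relation.Unary.Unique.Propositional.Properties as Unique
open import Data.Nat
  using (ℕ; zero; suc; _+_; _*_; _^_; _∸_; _/_; _%_; _≤_; _<_; _≤?_; _<?_; z≤n; s≤s;
         NonZero; >-nonZero; >-nonZero⁻¹)
open import Data.Nat.DivMod using (m%n<n; m≡m%n+[m/n]*n; m/n*n≤m)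
open import Data.Nat.Induction using (<-wellFounded)
open import Data.Nat.Properties as ℕ hiding (suc-injective; _≟_)
open import Data.Nat.Tactic.RingSolver using (solve-∀)
open import Data.Product using (∃-syntax; Σ-syntax; _×_; _,_; proj₁; proj₂)
open import Data.Sum using (_⊎_; inj₁; inj₂; [_,_]′)
open import Data.Vec using (tabulate; here; there)
  renaming ([] to []ᵥ; _∷_ to _∷ᵥ_; lookup to lookupᵥ)
open import Data.Vec.Properties using ([]=⇒lookup; lookup⇒[]=; lookup∘tabulate)
open import Algebra.Properties.CommutativeMonoid.Sum +-0-commutativeMonoid
  using (sum; sum-cong-≗; ∑-distrib-+; ∑-comm; sum-syntax)
open import Algebra.Properties.Semiring.Sum +-*-semiring using (*-distribˡ-sum; *-distribʳ-sum)
open import Function using (_∘_; id)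
open import Function.Bundles using (mk↣; mk↔; mk⇔)
open import Induction.WellFounded using (Acc; acc)
open import Level using (0ℓ)
open import Relation.Binary using (Rel; Decidable)
open import Relation.Binary.PropositionalEquality
  using (_≡_; refl; sym; trans; cong; cong₂; subst; module ≡-Reasoning)
open import Relation.Nullary using (¬_; Dec; does; yes; no; ¬?; _×-dec_; contradiction)
open import Relation.Nullary.Decidable using (dec-true)
open import Relation.Unary as U using (Pred)

-- Finite sets: cardinalities, selection of elements, minimisation over subsets.

comprehension : ∀ {n} {P : Pred (Fin n) 0ℓ} → U.Decidable P → Subset n
comprehension P? = tabulate (does ∘ P?)

module _ {n} {P : Pred (Fin n) 0ℓ} (P? : U.Decidable P) where

  ∈-comprehension⁺ : ∀ {x} → P x → x ∈ comprehension P?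
  ∈-comprehension⁺ {x} px =
    lookup⇒[]= x _ (trans (lookup∘tabulate (does ∘ P?) x) (dec-true (P? x) px))

  ∈-comprehension⁻ : ∀ {x} → x ∈ comprehension P? → P x
  ∈-comprehension⁻ {x} x∈ with P? x | trans (sym (lookup∘tabulate (does ∘ P?) x)) ([]=⇒lookup x∈)
  ... | yes px | _  = px
  ... | no  _  | ()

∣p∪q∣≤∣p∣+∣q∣ : ∀ {n} (p q : Subset n) → ∣ p ∪ q ∣ ≤ ∣ p ∣ + ∣ q ∣
∣p∪q∣≤∣p∣+∣q∣ []ᵥ []ᵥ = z≤n
∣p∪q∣≤∣p∣+∣q∣ (outside ∷ᵥ p) (outside ∷ᵥ q) = ∣p∪q∣≤∣p∣+∣q∣ p q
∣p∪q∣≤∣p∣+∣q∣ (outside ∷ᵥ p) (inside  ∷ᵥ q) =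
  ≤-trans (s≤s (∣p∪q∣≤∣p∣+∣q∣ p q)) (≤-reflexive (sym (+-suc ∣ p ∣ ∣ q ∣)))
∣p∪q∣≤∣p∣+∣q∣ (inside  ∷ᵥ p) (outside ∷ᵥ q) = s≤s (∣p∪q∣≤∣p∣+∣q∣ p q)
∣p∪q∣≤∣p∣+∣q∣ (inside  ∷ᵥ p) (inside  ∷ᵥ q) =
  s≤s (≤-trans (∣p∪q∣≤∣p∣+∣q∣ p q) (+-monoʳ-≤ ∣ p ∣ (n≤1+n ∣ q ∣)))

disjoint⇒∣p∣+∣q∣≤∣p∪q∣ : ∀ {n} (p q : Subset n) → (∀ {x} → x ∈ p → x ∉ q) →
                         ∣ p ∣ + ∣ q ∣ ≤ ∣ p ∪ q ∣
disjoint⇒∣p∣+∣q∣≤∣p∪q∣ []ᵥ []ᵥ _ = z≤n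
disjoint⇒∣p∣+∣q∣≤∣p∪q∣ (outside ∷ᵥ p) (outside ∷ᵥ q) disj =
  disjoint⇒∣p∣+∣q∣≤∣p∪q∣ p q (λ x∈p x∈q → disj (there x∈p) (there x∈q))
disjoint⇒∣p∣+∣q∣≤∣p∪q∣ (outside ∷ᵥ p) (inside  ∷ᵥ q) disj =
  ≤-trans (≤-reflexive (+-suc ∣ p ∣ ∣ q ∣))
    (s≤s (disjoint⇒∣p∣+∣q∣≤∣p∪q∣ p q (λ x∈p x∈q → disj (there x∈p) (there x∈q))))
disjoint⇒∣p∣+∣q∣≤∣p∪q∣ (inside  ∷ᵥ p) (outside ∷ᵥ q) disj =
  s≤s (disjoint⇒∣p∣+∣q∣≤∣p∪q∣ p q (λ x∈p x∈q → disj (there x∈p) (there x∈q)))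
disjoint⇒∣p∣+∣q∣≤∣p∪q∣ (inside  ∷ᵥ p) (inside  ∷ᵥ q) disj = contradiction here (disj here)

fromList : ∀ {n} → List (Fin n) → Subset n
fromList xs = ⋃ (List.map ⁅_⁆ xs)

∈-fromList⁺ : ∀ {n} {x : Fin n} {xs} → x List∈.∈ xs → x ∈ fromList xs
∈-fromList⁺ {x = x} (Any.here refl) = x∈p∪q⁺ (inj₁ (x∈⁅x⁆ x))
∈-fromList⁺ (Any.there x∈xs) = x∈p∪q⁺ (inj₂ (∈-fromList⁺ x∈xs))

∣fromList∣≤length : ∀ {n} (xs : List (Fin n)) → ∣ fromList xs ∣ ≤ length xs
∣fromList∣≤length {n} [] = ≤-reflexive (∣⊥∣≡0 n)
∣fromList∣≤length (x ∷ xs) = ≤-trans (∣p∪q∣≤∣p∣+∣q∣ ⁅ x ⁆ (fromList xs))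
  (+-mono-≤ (≤-reflexive (∣⁅x⁆∣≡1 x)) (∣fromList∣≤length xs))

choose : ∀ {n} (p : Subset n) ℓ → ℓ ≤ ∣ p ∣ →
         Σ[ b ∈ (Fin ℓ → Fin n) ] (∀ {i j} → b i ≡ b j → i ≡ j) × (∀ i → b i ∈ p)
choose p zero _ = (λ ()) , (λ {}) , λ ()
choose (outside ∷ᵥ p) (suc ℓ) ℓ≤ with choose p (suc ℓ) ℓ≤
... | b , inj , b∈ = suc ∘ b , inj ∘ suc-injective , there ∘ b∈
choose (inside ∷ᵥ p) (suc ℓ) (s≤s ℓ≤) with choose p ℓ ℓ≤
... | b , inj , b∈ = b′ , (λ {i} {j} → inj′ i j) , b′∈
  where
  b′ : Fin (suc ℓ) → Fin _
  b′ zero    = zero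
  b′ (suc i) = suc (b i)
  inj′ : ∀ i j → b′ i ≡ b′ j → i ≡ j
  inj′ zero    zero    _  = refl
  inj′ (suc i) (suc j) eq = cong suc (inj (suc-injective eq))
  b′∈ : ∀ i → b′ i ∈ inside ∷ᵥ p
  b′∈ zero    = here
  b′∈ (suc i) = there (b∈ i)

-- Translates `outdegree`, a length of a filtered list, into the size of a subset. The function `f`
-- is arbitrary so that the induction can pass to `f ∘ suc`.
length-filter-tabulate : ∀ {n} {A : Set} {P : Pred A 0ℓ} (P? : U.Decidable P) (f : Fin n → A) →
  length (filter P? (List.tabulate f)) ≡ ∣ comprehension (P? ∘ f) ∣
length-filter-tabulate {zero}  P? f = refl
length-filter-tabulate {suc n} P? f with does (P? (f zero))
... | true  = cong suc (length-filter-tabulate P? (f ∘ suc))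
... | false = length-filter-tabulate P? (f ∘ suc)

-- Descent on the value of `f`: `anySubset?` decides whether some admissible subset does better, and
-- each move to such a subset lowers a natural number.
argmin : ∀ {n} {P : Pred (Subset n) 0ℓ} → U.Decidable P → (f : Subset n → ℕ) → ∀ {p₀} → P p₀ →
         ∃[ p ] P p × (∀ {q} → P q → f p ≤ f q)
argmin {n} {P} P? f {p₀} Pp₀ = go p₀ Pp₀ (<-wellFounded (f p₀))
  where
  go : ∀ p → P p → Acc _<_ (f p) → ∃[ p ] P p × (∀ {q} → P q → f p ≤ f q)
  go p Pp (acc rec) with anySubset? (λ q → P? q ×-dec f q <? f p)
  ... | yes (q , Pq , fq<fp) = go q Pq (rec fq<fp)
  ... | no  ¬smaller         = p , Pp , λ Pq → ≮⇒≥ (λ fq<fp → ¬smaller (_ , Pq , fq<fp))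

-- Double counting of in- and outdegrees.

indicator : ∀ {n} → Subset n → Fin n → ℕ
indicator p i = if lookupᵥ p i then 1 else 0

∣p∣≡∑ : ∀ {n} (p : Subset n) → ∣ p ∣ ≡ sum (indicator p)
∣p∣≡∑ []ᵥ = refl
∣p∣≡∑ (outside ∷ᵥ p) = ∣p∣≡∑ p
∣p∣≡∑ (inside  ∷ᵥ p) = cong suc (∣p∣≡∑ p)

sum-mono : ∀ {n} {f g : Fin n → ℕ} → (∀ i → f i ≤ g i) → sum f ≤ sum g
sum-mono {zero}  f≤g = z≤n
sum-mono {suc n} f≤g = +-mono-≤ (f≤g zero) (sum-mono (f≤g ∘ suc))

-- Both sides count the pairs in `R`: the 0/1 matrix of `R` is summed by rows and by columns.
∑-∣∣-comm : ∀ {n} {R : Rel (Fin n) 0ℓ} (R? : Decidable R) →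
  ∑[ x < n ] ∣ comprehension (R? x) ∣ ≡ ∑[ y < n ] ∣ comprehension (λ x → R? x y) ∣
∑-∣∣-comm {n} R? = begin
  ∑[ x < n ] ∣ comprehension (R? x) ∣  ≡⟨ sum-cong-≗ (λ x → size (R? x)) ⟩
  ∑[ x < n ] ∑[ y < n ] [R] x y       ≡⟨ ∑-comm [R] ⟩
  ∑[ y < n ] ∑[ x < n ] [R] x y       ≡⟨ sum-cong-≗ (λ y → size (λ x → R? x y)) ⟨
  ∑[ y < n ] ∣ comprehension (λ x → R? x y) ∣ ∎
  where
  open ≡-Reasoning
  [R] : Fin n → Fin n → ℕ
  [R] x y = if does (R? x y) then 1 else 0
  size : ∀ {P : Pred (Fin n) 0ℓ} (P? : U.Decidable P) →
         ∣ comprehension P? ∣ ≡ ∑[ i < n ] (if does (P? i) then 1 else 0)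
  size P? = trans (∣p∣≡∑ (comprehension P?))
    (sum-cong-≗ (λ i → cong (if_then 1 else 0) (lookup∘tabulate (does ∘ P?) i)))

indicator-∈ : ∀ {n} {p : Subset n} {i} → i ∈ p → indicator p i ≡ 1
indicator-∈ i∈p = cong (if_then 1 else 0) ([]=⇒lookup i∈p)

indicator-∉ : ∀ {n} {p : Subset n} {i} → i ∉ p → indicator p i ≡ 0
indicator-∉ {p = p} {i} i∉p with lookupᵥ p i in eq
... | true  = contradiction (lookup⇒[]= i p eq) i∉p
... | false = refl

∑-indicator-* : ∀ {n} (p : Subset n) c → ∑[ i < n ] (indicator p i * c) ≡ ∣ p ∣ * c
∑-indicator-* p c = trans (sym (*-distribʳ-sum c (indicator p))) (cong (_* c) (sym (∣p∣≡∑ p)))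

module DoubleCounting {n} {R : Rel (Fin n) 0ℓ} (R? : Decidable R) (A : Subset n)
  (R⊆A : ∀ {x y} → R x y → x ∈ A × y ∈ A) where

  outNbrs inNbrs : Fin n → Subset n
  outNbrs x = comprehension (R? x)
  inNbrs  y = comprehension (λ x → R? x y)

  inNbrs⊆A : ∀ y → inNbrs y ⊆ A
  inNbrs⊆A y x∈ = proj₁ (R⊆A (∈-comprehension⁻ (λ x → R? x y) x∈))

  inNbrs-∉ : ∀ {y} → y ∉ A → inNbrs y ⊆ ⊥
  inNbrs-∉ {y} y∉A x∈ = contradiction (proj₂ (R⊆A (∈-comprehension⁻ (λ x → R? x y) x∈))) y∉A

  module _ (d ℓ : ℕ) where

    -- Indegree at least `d/2 − ℓ`, doubled and written without subtraction.
    Popular : Pred (Fin n) 0ℓ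
    Popular y = y ∈ A × d ≤ 2 * ∣ inNbrs y ∣ + 2 * ℓ

    popular? : U.Decidable Popular
    popular? y = y ∈? A ×-dec d ≤? 2 * ∣ inNbrs y ∣ + 2 * ℓ

    popular : Subset n
    popular = comprehension popular?

  module _ {d ℓ} (2ℓ≤d : 2 * ℓ ≤ d) (out≥ : ∀ {x} → x ∈ A → d ≤ 2 * ∣ outNbrs x ∣) where

    private
      out-bound : ∀ x → indicator A x * d ≤ 2 * ∣ outNbrs x ∣
      out-bound x with x ∈? A
      ... | yes x∈A rewrite indicator-∈ x∈A | *-identityˡ d = out≥ x∈A
      ... | no  x∉A rewrite indicator-∉ x∉A = z≤n

      in-bound : ∀ y → 2 * ∣ inNbrs y ∣ + indicator A y * (2 * ℓ) ≤
                       indicator A y * d + indicator (popular d ℓ) y * (2 * ∣ A ∣)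
      in-bound y with y ∈? A
      ... | no y∉A rewrite indicator-∉ y∉A = begin
        2 * ∣ inNbrs y ∣ + 0  ≡⟨ +-identityʳ _ ⟩
        2 * ∣ inNbrs y ∣      ≤⟨ *-monoʳ-≤ 2 (p⊆q⇒∣p∣≤∣q∣ (inNbrs-∉ y∉A)) ⟩
        2 * ∣ ⊥ {n} ∣         ≡⟨ cong (2 *_) (∣⊥∣≡0 n) ⟩
        0                     ≤⟨ z≤n ⟩
        _                     ∎
        where open ≤-Reasoning
      ... | yes y∈A with popular? d ℓ y
      -- Of the indegree of a popular vertex only the trivial bound `∣ A ∣` is used. The `2 * ℓ`
      -- charged to every vertex of `A` is absorbed by `d`; this is where `2ℓ≤d` enters.
      ...   | yes pop rewrite indicator-∈ y∈A | indicator-∈ (∈-comprehension⁺ (popular? d ℓ) pop) = begin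
        2 * ∣ inNbrs y ∣ + 1 * (2 * ℓ)  ≤⟨ +-mono-≤
          (*-monoʳ-≤ 2 (p⊆q⇒∣p∣≤∣q∣ (inNbrs⊆A y)))
          (*-monoʳ-≤ 1 2ℓ≤d) ⟩
        2 * ∣ A ∣ + 1 * d               ≡⟨ rearrange ∣ A ∣ d ⟩
        1 * d + 1 * (2 * ∣ A ∣)         ∎
        where
        open ≤-Reasoning
        rearrange : ∀ a d → 2 * a + 1 * d ≡ 1 * d + 1 * (2 * a)
        rearrange = solve-∀
      ...   | no ¬pop rewrite indicator-∈ y∈A = begin
        2 * ∣ inNbrs y ∣ + 1 * (2 * ℓ)  ≡⟨ cong (2 * ∣ inNbrs y ∣ +_) (*-identityˡ (2 * ℓ)) ⟩
        2 * ∣ inNbrs y ∣ + 2 * ℓ        ≤⟨ ≰⇒≥ (λ d≤ → ¬pop (y∈A , d≤)) ⟩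
        d                               ≡⟨ *-identityˡ d ⟨
        1 * d                           ≤⟨ m≤m+n (1 * d) _ ⟩
        _                               ∎
        where open ≤-Reasoning

    -- Counted by tails, `R` has at least `∣ A ∣ * d/2` pairs. Counted by heads, it has at most
    -- `∣ A ∣ * (d/2 − ℓ)` plus `∣ A ∣` for each popular vertex. Comparing the two and dividing by
    -- `∣ A ∣` leaves `ℓ` popular vertices. The calculation doubles everything and moves `ℓ` to the
    -- left to avoid fractions and subtraction.
    ∣popular∣≥ℓ : Nonempty A → ℓ ≤ ∣ popular d ℓ ∣
    ∣popular∣≥ℓ (x , x∈A) = *-cancelʳ-≤ ℓ ∣H∣ (2 * a) {{m*n≢0 2 a {{_}} {{>-nonZero 0<a}}}}
      (+-cancelˡ-≤ (a * d) _ _ (begin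
        a * d + ℓ * (2 * a)    ≡⟨ rearrange a d ℓ ⟩
        a * d + a * (2 * ℓ)    ≡⟨ cong (_+ _) (∑-indicator-* A d) ⟨
        ∑[ x < n ] (indicator A x * d) + a * (2 * ℓ)
                               ≤⟨ +-monoˡ-≤ _ (sum-mono out-bound) ⟩
        ∑[ x < n ] (2 * ∣ outNbrs x ∣) + a * (2 * ℓ)
                               ≡⟨ cong₂ _+_ double (sym (∑-indicator-* A (2 * ℓ))) ⟩
        ∑[ y < n ] (2 * ∣ inNbrs y ∣) + ∑[ y < n ] (indicator A y * (2 * ℓ))
                               ≡⟨ ∑-distrib-+ (λ y → 2 * ∣ inNbrs y ∣) (λ y → indicator A y * (2 * ℓ)) ⟨
        ∑[ y < n ] (2 * ∣ inNbrs y ∣ + indicator A y * (2 * ℓ))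
                               ≤⟨ sum-mono in-bound ⟩
        ∑[ y < n ] (indicator A y * d + indicator H y * (2 * a))
                               ≡⟨ ∑-distrib-+ (λ y → indicator A y * d) (λ y → indicator H y * (2 * a)) ⟩
        ∑[ y < n ] (indicator A y * d) + ∑[ y < n ] (indicator H y * (2 * a))
                               ≡⟨ cong₂ _+_ (∑-indicator-* A d) (∑-indicator-* H (2 * a)) ⟩
        a * d + ∣H∣ * (2 * a)  ∎))
      where
      open ≤-Reasoning
      H = popular d ℓ
      a = ∣ A ∣
      ∣H∣ = ∣ H ∣
      0<a : 0 < a
      0<a = ≤-trans (≤-reflexive (sym (∣⁅x⁆∣≡1 x)))
        (p⊆q⇒∣p∣≤∣q∣ (λ y∈ → subst (_∈ A) (sym (x∈⁅y⁆⇒x≡y x y∈)) x∈A))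
      rearrange : ∀ a d ℓ → a * d + ℓ * (2 * a) ≡ a * d + a * (2 * ℓ)
      rearrange = solve-∀
      double : ∑[ x < n ] (2 * ∣ outNbrs x ∣) ≡ ∑[ y < n ] (2 * ∣ inNbrs y ∣)
      double = trans (sym (*-distribˡ-sum 2 (λ x → ∣ outNbrs x ∣)))
        (trans (cong (2 *_) (∑-∣∣-comm R?)) (*-distribˡ-sum 2 (λ y → ∣ inNbrs y ∣)))

-- Walks and their interior vertices.

-- The index is the list of interior vertices only, because these are what must be new and disjoint
-- in a subdivision; a single edge has the empty list. Repetitions are excluded separately by
-- `Unique`.
data Walk {V : Set} (R : Rel V 0ℓ) : V → List V → V → Set where
  edge : ∀ {x y} → R x y → Walk R x [] y
  _∷_  : ∀ {x y z zs} → R x z → Walk R z zs y → Walk R x (z ∷ zs) y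

module _ {V : Set} {R : Rel V 0ℓ} where

  _∷ʳ_ : ∀ {x y z zs} → Walk R x zs y → R y z → Walk R x (zs ++ [ y ]) z
  edge r  ∷ʳ s = r ∷ edge s
  (r ∷ w) ∷ʳ s = r ∷ (w ∷ʳ s)

  -- This lemma and the next three answer the four constructors of `Subdivide.Step`, in the same
  -- order.
  walk-direct : ∀ {x y zs} → Walk R x zs y → length zs ≡ 0 → R x y
  walk-direct (edge r) _ = r

  walk-first : ∀ {x y zs} → Walk R x zs y → ∀ i → toℕ i ≡ 0 → R x (lookup zs i)
  walk-first (r ∷ _) zero _ = r

  walk-next : ∀ {x y zs} → Walk R x zs y → ∀ i j → toℕ j ≡ suc (toℕ i) →
              R (lookup zs i) (lookup zs j)
  walk-next (_ ∷ w) zero    (suc j) eq = walk-first w j (ℕ.suc-injective eq)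
  walk-next (_ ∷ w) (suc i) (suc j) eq = walk-next w i j (ℕ.suc-injective eq)

  walk-last : ∀ {x y zs} → Walk R x zs y → ∀ i → suc (toℕ i) ≡ length zs → R (lookup zs i) y
  walk-last (_ ∷ edge r)      zero    _  = r
  walk-last (_ ∷ (_ ∷ _))     zero    ()
  walk-last (_ ∷ w@(_ ∷ _))   (suc i) eq = walk-last w i (ℕ.suc-injective eq)

-- Boundaries, and breadth-first search around forbidden vertices.

module _ {n} {R : Rel (Fin n) 0ℓ} (R? : Decidable R) where

  Boundary : Subset n → Pred (Fin n) 0ℓ
  Boundary B y = y ∉ B × ∃[ x ] x ∈ B × R x y

  boundary? : ∀ B → U.Decidable (Boundary B)
  boundary? B y = ¬? (y ∈? B) ×-dec any? (λ x → x ∈? B ×-dec R? x y)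

  boundary : Subset n → Subset n
  boundary B = comprehension (boundary? B)

module Search {n} {R : Rel (Fin n) 0ℓ} (R? : Decidable R) (A : Subset n)
  (R⊆A : ∀ {x y} → R x y → x ∈ A × y ∈ A) {d ℓ : ℕ}
  (expand : ∀ {B} → B ⊆ A → Nonempty B → d * ∣ A ∣ ≤ d * ∣ B ∣ + 2 * n * ∣ boundary R? B ∣)
  (X : Subset n) (X-small : 8 * n * ∣ X ∣ + 4 * d * ℓ ≤ d * d)
  {s t : Fin n} (s∈A : s ∈ A)
  (t-popular : d ≤ 2 * ∣ comprehension (λ x → R? x t) ∣ + 2 * ℓ) where

  open DoubleCounting R? A R⊆A using (inNbrs; inNbrs⊆A)

  -- s and t may coincide, the walk then being a closed one.
  record Path (k : ℕ) : Set where
    field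
      interior : List (Fin n)
      walk     : Walk R s interior t
      unique   : Unique interior
      avoids   : All (_∉ X) interior
      short    : length interior ≤ k

  private
    -- walk leaves the last step open: appending any out-edge of x gives a
    -- walk whose interior lies in B, so x itself may be the start s.
    record Reached (B : Subset n) (k : ℕ) (x : Fin n) : Set where
      field
        interior : List (Fin n)
        walk     : ∀ {y} → R x y → Walk R s interior y
        unique   : Unique interior
        avoids   : All (_∉ X) interior
        inside-B : All (_∈ B) interior
        short    : length interior ≤ k

    -- `large` says that the `k` layers added so far have at least `d²/8n` vertices on average.
    record Ball (k : ℕ) : Set where
      field
        B       : Subset n
        B⊆A     : B ⊆ A
        s∈B     : s ∈ B
        reached : ∀ {x} → x ∈ B → Reached B k x
        large   : k * (d * d) ≤ 8 * n * ∣ B ∣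

      hit? : Dec (∃[ x ] x ∈ B × R x t)
      hit? = any? (λ x → x ∈? B ×-dec R? x t)

      hit⇒path : ∃[ x ] x ∈ B × R x t → Path k
      hit⇒path (x , x∈B , Rxt) = record
        { interior = interior ; walk = walk Rxt ; unique = unique ; avoids = avoids ; short = short }
        where open Reached (reached x∈B)

      ∣B∣+∣in∣≤∣A∣ : ¬ (∃[ x ] x ∈ B × R x t) → ∣ B ∣ + ∣ inNbrs t ∣ ≤ ∣ A ∣
      ∣B∣+∣in∣≤∣A∣ ¬hit = ≤-trans
        (disjoint⇒∣p∣+∣q∣≤∣p∪q∣ B (inNbrs t)
          (λ x∈B x∈in → ¬hit (_ , x∈B , ∈-comprehension⁻ (λ x → R? x t) x∈in)))
        (p⊆q⇒∣p∣≤∣q∣ (λ x∈ → [ B⊆A , inNbrs⊆A t ]′ (x∈p∪q⁻ B (inNbrs t) x∈)))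

    start : Ball 0
    start = record
      -- `s` may be forbidden, as branch vertices will be: it lies in every later `B`, and only
      -- vertices outside `B` are appended to interiors.
      { B = ⁅ s ⁆
      ; B⊆A = λ x∈ → subst (_∈ A) (sym (x∈⁅y⁆⇒x≡y s x∈)) s∈A
      ; s∈B = x∈⁅x⁆ s
      ; reached = λ x∈ → record
          { interior = []
          ; walk = λ {y} r → edge (subst (λ x → R x y) (x∈⁅y⁆⇒x≡y s x∈) r)
          ; unique = [] ; avoids = [] ; inside-B = [] ; short = z≤n }
      ; large = z≤n
      }

    grow : ∀ {k} (ball : Ball k) → ¬ (∃[ x ] x ∈ Ball.B ball × R x t) → Ball (suc k)
    grow {k} ball ¬hit = record
      { B = B ∪ S
      ; B⊆A = λ x∈ → [ B⊆A , S⊆A ]′ (x∈p∪q⁻ B S x∈)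
      ; s∈B = x∈p∪q⁺ (inj₁ s∈B)
      ; reached = λ x∈ → [ reached-B , reached-S ]′ (x∈p∪q⁻ B S x∈)
      ; large = large′
      }
      where
      open Ball ball
      New : Pred (Fin n) 0ℓ
      New y = y ∉ X × Boundary R? B y
      new? : U.Decidable New
      new? y = ¬? (y ∈? X) ×-dec boundary? R? B y
      S = comprehension new?

      S⊆A : S ⊆ A
      S⊆A y∈ = let _ , _ , _ , _ , r = ∈-comprehension⁻ new? y∈ in proj₂ (R⊆A r)

      reached-B : ∀ {x} → x ∈ B → Reached (B ∪ S) (suc k) x
      reached-B x∈B = record
        { interior = interior ; walk = walk ; unique = unique ; avoids = avoids
        ; inside-B = All.map (λ x∈ → x∈p∪q⁺ (inj₁ x∈)) inside-B ; short = m≤n⇒m≤1+n short }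
        where open Reached (reached x∈B)

      reached-S : ∀ {y} → y ∈ S → Reached (B ∪ S) (suc k) y
      reached-S {y} y∈S with ∈-comprehension⁻ new? y∈S
      ... | y∉X , y∉B , x , x∈B , r = record
        { interior = interior ++ [ y ]
        ; walk = λ r′ → walk r ∷ʳ r′
        -- The earlier interior lies in `B` and `y` does not; `inside-B` is carried along for this.
        ; unique = Unique.++⁺ unique ([] ∷ [])
            (λ { (y∈xs , Any.here refl) → y∉B (All.lookup inside-B y∈xs) })
        ; avoids = All.++⁺ avoids (y∉X ∷ [])
        ; inside-B = All.++⁺ (All.map (λ x∈ → x∈p∪q⁺ (inj₁ x∈)) inside-B) (x∈p∪q⁺ (inj₂ y∈S) ∷ [])
        ; short = ≤-trans (≤-reflexive (trans (length-++ interior) (+-comm _ 1))) (s≤s short)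
        }
        where open Reached (reached x∈B)

      boundary⊆S∪X : boundary R? B ⊆ S ∪ X
      boundary⊆S∪X {y} y∈ with y ∈? X
      ... | yes y∈X = x∈p∪q⁺ (inj₂ y∈X)
      ... | no  y∉X =
        x∈p∪q⁺ (inj₁ (∈-comprehension⁺ new? (y∉X , ∈-comprehension⁻ (boundary? R? B) y∈)))

      -- Without a hit, the inneighbours of `t` lie in `A` outside `B`, so `∣ A ∣` exceeds `∣ B ∣`
      -- by at least their number. `expand` turns this gap into boundary vertices of `B`, each of
      -- which is new or forbidden.
      in-small : d * ∣ inNbrs t ∣ ≤ 2 * n * (∣ S ∣ + ∣ X ∣)
      in-small = +-cancelˡ-≤ (d * ∣ B ∣) _ _ (begin
        d * ∣ B ∣ + d * ∣ inNbrs t ∣           ≡⟨ *-distribˡ-+ d ∣ B ∣ _ ⟨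
        d * (∣ B ∣ + ∣ inNbrs t ∣)             ≤⟨ *-monoʳ-≤ d (∣B∣+∣in∣≤∣A∣ ¬hit) ⟩
        d * ∣ A ∣                              ≤⟨ expand B⊆A (s , s∈B) ⟩
        d * ∣ B ∣ + 2 * n * ∣ boundary R? B ∣  ≤⟨ +-monoʳ-≤ (d * ∣ B ∣) (*-monoʳ-≤ (2 * n)
          (≤-trans (p⊆q⇒∣p∣≤∣q∣ boundary⊆S∪X) (∣p∪q∣≤∣p∣+∣q∣ S X))) ⟩
        d * ∣ B ∣ + 2 * n * (∣ S ∣ + ∣ X ∣)    ∎)
        where open ≤-Reasoning

      -- As `t` has indegree at least `d/2 − ℓ`, `in-small` bounds `d²/2` by `2n ∣S∣ + 2n ∣X∣ + dℓ`.
      -- By `X-small` the last two terms make up at most `d²/4`, so `2n ∣S∣` is at least `d²/4`.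
      S-large : d * d ≤ 8 * n * ∣ S ∣
      S-large = +-cancelʳ-≤ (d * d) _ _ (begin
        d * d + d * d                              ≡⟨ e₁ d ⟩
        2 * (d * d)                                ≤⟨ *-monoʳ-≤ 2 (*-monoʳ-≤ d t-popular) ⟩
        2 * (d * (2 * ∣ inNbrs t ∣ + 2 * ℓ))       ≡⟨ e₂ d ∣ inNbrs t ∣ ℓ ⟩
        4 * (d * ∣ inNbrs t ∣) + 4 * d * ℓ         ≤⟨ +-monoˡ-≤ (4 * d * ℓ) (*-monoʳ-≤ 4 in-small) ⟩
        4 * (2 * n * (∣ S ∣ + ∣ X ∣)) + 4 * d * ℓ  ≡⟨ e₃ d n ∣ S ∣ ∣ X ∣ ℓ ⟩
        8 * n * ∣ S ∣ + (8 * n * ∣ X ∣ + 4 * d * ℓ) ≤⟨ +-monoʳ-≤ (8 * n * ∣ S ∣) X-small ⟩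
        8 * n * ∣ S ∣ + d * d                      ∎)
        where
        open ≤-Reasoning
        e₁ : ∀ d → d * d + d * d ≡ 2 * (d * d)
        e₁ = solve-∀
        e₂ : ∀ d i ℓ → 2 * (d * (2 * i + 2 * ℓ)) ≡ 4 * (d * i) + 4 * d * ℓ
        e₂ = solve-∀
        e₃ : ∀ d n S X ℓ → 4 * (2 * n * (S + X)) + 4 * d * ℓ ≡ 8 * n * S + (8 * n * X + 4 * d * ℓ)
        e₃ = solve-∀

      large′ : suc k * (d * d) ≤ 8 * n * ∣ B ∪ S ∣
      large′ = begin
        d * d + k * (d * d)            ≤⟨ +-mono-≤ S-large large ⟩
        8 * n * ∣ S ∣ + 8 * n * ∣ B ∣  ≡⟨ +-comm (8 * n * ∣ S ∣) _ ⟩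
        8 * n * ∣ B ∣ + 8 * n * ∣ S ∣  ≡⟨ *-distribˡ-+ (8 * n) ∣ B ∣ _ ⟨
        8 * n * (∣ B ∣ + ∣ S ∣)        ≤⟨ *-monoʳ-≤ (8 * n) (disjoint⇒∣p∣+∣q∣≤∣p∪q∣ B S
          (λ x∈B x∈S → proj₁ (proj₂ (∈-comprehension⁻ new? x∈S)) x∈B)) ⟩
        8 * n * ∣ B ∪ S ∣              ∎
        where open ≤-Reasoning

    explore : ∀ k → Path k ⊎ Ball k
    explore zero = inj₂ start
    explore (suc k) with explore k
    ... | inj₁ path = inj₁ (record { Path path ; short = m≤n⇒m≤1+n (Path.short path) })
    ... | inj₂ ball with Ball.hit? ball
    ...   | yes hit = inj₁ (record { Path path ; short = m≤n⇒m≤1+n (Path.short path) })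
      where path = Ball.hit⇒path ball hit
    ...   | no ¬hit = inj₂ (grow ball ¬hit)

  -- After `T` layers without a hit, `B` has at least `T d²/8n` vertices and is disjoint from the
  -- inneighbourhood of `t`, which has at least `d/2 − ℓ`. Under the hypothesis these are more than
  -- `n` in all. Counting the inneighbourhood produces the term `4 * n * d`, which `budget` relies
  -- on.
  findPath : ∀ {T} → 8 * n * n + 8 * n * ℓ < T * (d * d) + 4 * n * d → Path T
  findPath {T} T-large with explore T
  ... | inj₁ path = path
  ... | inj₂ ball with Ball.hit? ball
  ...   | yes hit = Ball.hit⇒path ball hit
  ...   | no ¬hit = contradiction T-large (≤⇒≯ (begin
    T * (d * d) + 4 * n * d
      ≤⟨ +-mono-≤ large (*-monoʳ-≤ (4 * n) t-popular) ⟩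
    8 * n * ∣ B ∣ + 4 * n * (2 * ∣ inNbrs t ∣ + 2 * ℓ)
      ≡⟨ rearrange n ∣ B ∣ ∣ inNbrs t ∣ ℓ ⟩
    8 * n * (∣ B ∣ + ∣ inNbrs t ∣) + 8 * n * ℓ
      ≤⟨ +-monoˡ-≤ (8 * n * ℓ) (*-monoʳ-≤ (8 * n) (≤-trans (∣B∣+∣in∣≤∣A∣ ¬hit) (∣p∣≤n A))) ⟩
    8 * n * n + 8 * n * ℓ ∎))
    where
    open ≤-Reasoning
    open Ball ball
    rearrange : ∀ n b i ℓ → 8 * n * b + 4 * n * (2 * i + 2 * ℓ) ≡ 8 * n * (b + i) + 8 * n * ℓ
    rearrange = solve-∀

-- A vertex set with large outdegrees and expansion inside it.

Within : ∀ {n} → Rel (Fin n) 0ℓ → Subset n → Rel (Fin n) 0ℓ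
Within E A x y = x ∈ A × y ∈ A × E x y

within? : ∀ {n} {E : Rel (Fin n) 0ℓ} → Decidable E → ∀ A → Decidable (Within E A)
within? E? A x y = x ∈? A ×-dec y ∈? A ×-dec E? x y

Within⊆ : ∀ {n} (E : Rel (Fin n) 0ℓ) A {x y} → Within E A x y → x ∈ A × y ∈ A
Within⊆ E A (x∈A , y∈A , _) = x∈A , y∈A

module _ {n d} .{{_ : NonZero n}} {E : Rel (Fin n) 0ℓ} (E? : Decidable E)
  (out≥d : ∀ x → d ≤ ∣ comprehension (E? x) ∣) where

  -- A nonempty A minimising weight A = d ∣A∣ + 2n ∣∂A∣ has both properties:
  -- weight A ≤ weight V = dn gives 2 ∣∂A∣ ≤ d, hence out≥, while comparing
  -- A with B gives expand, because the boundary of B in the whole digraph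
  -- lies in ∂A together with the boundary of B inside A.
  record Core : Set where
    field
      A        : Subset n
      nonempty : Nonempty A
      out≥     : ∀ {x} → x ∈ A → d ≤ 2 * ∣ comprehension (within? E? A x) ∣
      expand   : ∀ {B} → B ⊆ A → Nonempty B →
                 d * ∣ A ∣ ≤ d * ∣ B ∣ + 2 * n * ∣ boundary (within? E? A) B ∣

  private
    weight : Subset n → ℕ
    weight A = d * ∣ A ∣ + 2 * n * ∣ boundary E? A ∣

    weight-⊤ : weight ⊤ ≤ d * n
    weight-⊤ = begin
      d * ∣ ⊤ {n} ∣ + 2 * n * ∣ boundary E? ⊤ ∣
        ≤⟨ +-mono-≤ (*-monoʳ-≤ d (∣p∣≤n (⊤ {n}))) (*-monoʳ-≤ (2 * n) (p⊆q⇒∣p∣≤∣q∣ boundary⊆⊥)) ⟩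
      d * n + 2 * n * ∣ ⊥ {n} ∣
        ≡⟨ cong (d * n +_) (trans (cong (2 * n *_) (∣⊥∣≡0 n)) (*-zeroʳ (2 * n))) ⟩
      d * n + 0
        ≡⟨ +-identityʳ (d * n) ⟩
      d * n ∎
      where
      open ≤-Reasoning
      boundary⊆⊥ : boundary E? ⊤ ⊆ ⊥
      boundary⊆⊥ y∈ = contradiction ∈⊤ (proj₁ (∈-comprehension⁻ (boundary? E? ⊤) y∈))

    lightest⇒core : ∀ {A} → Nonempty A → (∀ {B} → Nonempty B → weight A ≤ weight B) →
                    weight A ≤ d * n → Core
    lightest⇒core {A} A≢∅ minimal light = record
      { A = A ; nonempty = A≢∅ ; out≥ = out≥ ; expand = expand }
      where
      ∂A = boundary E? A

      2∣∂A∣≤d : 2 * ∣ ∂A ∣ ≤ d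
      2∣∂A∣≤d = *-cancelʳ-≤ (2 * ∣ ∂A ∣) d n (begin
        2 * ∣ ∂A ∣ * n    ≡⟨ rearrange ∣ ∂A ∣ n ⟩
        2 * n * ∣ ∂A ∣    ≤⟨ m≤n+m _ (d * ∣ A ∣) ⟩
        weight A          ≤⟨ light ⟩
        d * n             ∎)
        where
        open ≤-Reasoning
        rearrange : ∀ b n → 2 * b * n ≡ 2 * n * b
        rearrange = solve-∀

      out≥ : ∀ {x} → x ∈ A → d ≤ 2 * ∣ comprehension (within? E? A x) ∣
      out≥ {x} x∈A = +-cancelʳ-≤ d _ _ (begin
        d + d                                  ≤⟨ +-mono-≤ d≤ d≤ ⟩
        (∣ inA ∣ + ∣ ∂A ∣) + (∣ inA ∣ + ∣ ∂A ∣)  ≡⟨ rearrange ∣ inA ∣ ∣ ∂A ∣ ⟩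
        2 * ∣ inA ∣ + 2 * ∣ ∂A ∣               ≤⟨ +-monoʳ-≤ (2 * ∣ inA ∣) 2∣∂A∣≤d ⟩
        2 * ∣ inA ∣ + d                        ∎)
        where
        open ≤-Reasoning
        inA = comprehension (within? E? A x)
        split : comprehension (E? x) ⊆ inA ∪ ∂A
        split {y} y∈ with y ∈? A | ∈-comprehension⁻ (E? x) y∈
        ... | yes y∈A | Exy = x∈p∪q⁺ (inj₁ (∈-comprehension⁺ (within? E? A x) (x∈A , y∈A , Exy)))
        ... | no  y∉A | Exy = x∈p∪q⁺ (inj₂ (∈-comprehension⁺ (boundary? E? A) (y∉A , x , x∈A , Exy)))
        d≤ : d ≤ ∣ inA ∣ + ∣ ∂A ∣
        d≤ = ≤-trans (out≥d x) (≤-trans (p⊆q⇒∣p∣≤∣q∣ split) (∣p∪q∣≤∣p∣+∣q∣ inA ∂A))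
        rearrange : ∀ a b → (a + b) + (a + b) ≡ 2 * a + 2 * b
        rearrange = solve-∀

      expand : ∀ {B} → B ⊆ A → Nonempty B →
               d * ∣ A ∣ ≤ d * ∣ B ∣ + 2 * n * ∣ boundary (within? E? A) B ∣
      expand {B} B⊆A B≢∅ = +-cancelʳ-≤ (2 * n * ∣ ∂A ∣) _ _ (begin
        weight A                                     ≤⟨ minimal B≢∅ ⟩
        d * ∣ B ∣ + 2 * n * ∣ boundary E? B ∣        ≤⟨ +-monoʳ-≤ (d * ∣ B ∣) (*-monoʳ-≤ (2 * n)
          (≤-trans (p⊆q⇒∣p∣≤∣q∣ split) (∣p∪q∣≤∣p∣+∣q∣ inA ∂A))) ⟩
        d * ∣ B ∣ + 2 * n * (∣ inA ∣ + ∣ ∂A ∣)       ≡⟨ rearrange (d * ∣ B ∣) n ∣ inA ∣ ∣ ∂A ∣ ⟩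
        d * ∣ B ∣ + 2 * n * ∣ inA ∣ + 2 * n * ∣ ∂A ∣ ∎)
        where
        open ≤-Reasoning
        inA = boundary (within? E? A) B
        split : boundary E? B ⊆ inA ∪ ∂A
        split {y} y∈ with y ∈? A | ∈-comprehension⁻ (boundary? E? B) y∈
        ... | yes y∈A | y∉B , x , x∈B , Exy = x∈p∪q⁺ (inj₁ (∈-comprehension⁺
          (boundary? (within? E? A) B) (y∉B , x , x∈B , B⊆A x∈B , y∈A , Exy)))
        ... | no  y∉A | y∉B , x , x∈B , Exy = x∈p∪q⁺ (inj₂ (∈-comprehension⁺
          (boundary? E? A) (y∉A , x , B⊆A x∈B , Exy)))
        rearrange : ∀ b n i a → b + 2 * n * (i + a) ≡ b + 2 * n * i + 2 * n * a
        rearrange = solve-∀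

  core : Fin n → Core
  core v with argmin nonempty? weight {⊤} (v , ∈⊤)
  ... | A , A≢∅ , minimal = lightest⇒core A≢∅ minimal (≤-trans (minimal (v , ∈⊤)) weight-⊤)

-- Greedy choice of disjoint paths, and the subdivision they form.

-- Induction on `m`: the list found for `zero` is added to the forbidden set `Y`, so all later lists
-- are disjoint from it. Each list costs at most `T` vertices, and the summand `m * T` reserves room
-- for those still to come.
greedy : ∀ {n} {X : Subset n} {C T} m (P : Fin m → Pred (List (Fin n)) 0ℓ) →
  (∀ e Y → X ⊆ Y → ∣ Y ∣ ≤ C → ∃[ xs ] P e xs × All (_∉ Y) xs × length xs ≤ T) →
  ∀ Y → X ⊆ Y → ∣ Y ∣ + m * T ≤ C →
  Σ[ f ∈ (Fin m → List (Fin n)) ] (∀ e → P e (f e)) × (∀ e → All (_∉ Y) (f e)) ×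
    (∀ {e e′ z} → z List∈.∈ f e → z List∈.∈ f e′ → e ≡ e′)
greedy zero P find Y X⊆Y _ = (λ ()) , (λ ()) , (λ ()) , λ { {e = ()} }
greedy {C = C} {T} (suc m) P find Y X⊆Y Y+≤C
  with find zero Y X⊆Y (≤-trans (m≤m+n ∣ Y ∣ _) Y+≤C)
... | xs , Pxs , xs∉Y , xs≤T
  with greedy m (P ∘ suc) (find ∘ suc) (Y ∪ fromList xs) (λ x∈X → x∈p∪q⁺ (inj₁ (X⊆Y x∈X))) (begin
    ∣ Y ∪ fromList xs ∣ + m * T        ≤⟨ +-monoˡ-≤ (m * T) (∣p∪q∣≤∣p∣+∣q∣ Y (fromList xs)) ⟩
    ∣ Y ∣ + ∣ fromList xs ∣ + m * T    ≤⟨ +-monoˡ-≤ (m * T)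
      (+-monoʳ-≤ ∣ Y ∣ (≤-trans (∣fromList∣≤length xs) xs≤T)) ⟩
    ∣ Y ∣ + T + m * T                  ≡⟨ +-assoc ∣ Y ∣ T _ ⟩
    ∣ Y ∣ + (T + m * T)                ≤⟨ Y+≤C ⟩
    C                                  ∎)
  where open ≤-Reasoning
... | f , Pf , f∉ , f-disjoint = g , Pg , g∉ , λ {e} {e′} → g-disjoint e e′
  where
  g : Fin (suc m) → List _
  g zero    = xs
  g (suc e) = f e

  Pg : ∀ e → P e (g e)
  Pg zero    = Pxs
  Pg (suc e) = Pf e

  g∉ : ∀ e → All (_∉ Y) (g e)
  g∉ zero    = xs∉Y
  g∉ (suc e) = All.map (λ z∉ z∈Y → z∉ (x∈p∪q⁺ (inj₁ z∈Y))) (f∉ e)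

  xs∩f : ∀ {e z} → z List∈.∈ xs → ¬ z List∈.∈ f e
  xs∩f z∈xs z∈fe = All.lookup (f∉ _) z∈fe (x∈p∪q⁺ (inj₂ (∈-fromList⁺ z∈xs)))

  g-disjoint : ∀ e e′ {z} → z List∈.∈ g e → z List∈.∈ g e′ → e ≡ e′
  g-disjoint zero    zero     _  _   = refl
  g-disjoint zero    (suc e′) z∈ z∈′ = contradiction z∈′ (xs∩f z∈)
  g-disjoint (suc e) zero     z∈ z∈′ = contradiction z∈ (xs∩f z∈′)
  g-disjoint (suc e) (suc e′) z∈ z∈′ = cong suc (f-disjoint z∈ z∈′)

lookup-injective : ∀ {A : Set} {xs : List A} → Unique xs → ∀ i j → lookup xs i ≡ lookup xs j → i ≡ j
lookup-injective (_ ∷ _)  zero    zero    _  = refl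
lookup-injective (x∉ ∷ _) zero    (suc j) eq = contradiction eq (All.lookup x∉ (∈-lookup j))
lookup-injective (x∉ ∷ _) (suc i) zero    eq = contradiction (sym eq) (All.lookup x∉ (∈-lookup i))
lookup-injective (_ ∷ u)  (suc i) (suc j) eq = cong suc (lookup-injective u i j eq)

-- The subdivision is `Subdivide.digraph` itself, with interior counts read off from `f`. Its
-- isomorphism is then the identity, and all the content lies in the embedding `to`.
linked⇒subdivision : ∀ {V : Set} {ℓ} (G : Digraph V)
  (b : Fin ℓ → V) → (∀ {i j} → b i ≡ b j → i ≡ j) →
  (f : Fin ℓ → Fin ℓ → List V) →
  (∀ i j → Walk (Edge G) (b i) (f i j) (b j)) →
  (∀ i j → Unique (f i j)) →
  (∀ i j h → ¬ b h List∈.∈ f i j) →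
  (∀ {i j i′ j′ z} → z List∈.∈ f i j → z List∈.∈ f i′ j′ → i ≡ i′ × j ≡ j′) →
  ContainsSubdivisionOf G (complete ℓ)
linked⇒subdivision {V} {ℓ} G b b-inj f walk unique b∉f f-disjoint =
  Vertex , digraph ,
  record { vertices = mk↣ {to = to} (to-injective _ _) ; edges = to-edge } ,
  k , record { vertices = mk↔ {to = id} {from = id} ((λ eq → eq) , (λ eq → eq)) ; edges = mk⇔ id id }
  where
  k : Fin ℓ → Fin ℓ → ℕ
  k i j = length (f i j)

  open Subdivide (complete ℓ) k

  to : Vertex → V
  to (branch i)      = b i
  to (inner i j _ p) = lookup (f i j) p

  to-injective : ∀ u v → to u ≡ to v → u ≡ v
  to-injective (branch i) (branch j) eq = cong branch (b-inj eq)
  to-injective (branch h) (inner i j _ p) eq =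
    contradiction (subst (List∈._∈ f i j) (sym eq) (∈-lookup p)) (b∉f i j h)
  to-injective (inner i j _ p) (branch h) eq =
    contradiction (subst (List∈._∈ f i j) eq (∈-lookup p)) (b∉f i j h)
  to-injective (inner i j i≢j p) (inner i′ j′ _ p′) eq
    with f-disjoint (subst (List∈._∈ f i j) eq (∈-lookup p)) (∈-lookup p′)
  -- The two vertices may carry different edge proofs, but `inner` takes them irrelevantly, so `i≢j`
  -- serves for both.
  ... | refl , refl = cong (inner i j i≢j) (lookup-injective (unique i j) p p′ eq)

  to-edge : ∀ {u v} → Step u v → Edge G (to u) (to v)
  to-edge (direct {i} {j} _ k≡0) = walk-direct (walk i j) k≡0
  to-edge (first {i} {j} {i = p} p≡0) = walk-first (walk i j) p p≡0
  to-edge (next {i} {j} {i = p} {q} eq) = walk-next (walk i j) p q eq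
  to-edge (last {i} {j} {i = p} eq) = walk-last (walk i j) p eq

walk-map : ∀ {V : Set} {R S : Rel V 0ℓ} → (∀ {x y} → R x y → S x y) →
           ∀ {x zs y} → Walk R x zs y → Walk S x zs y
walk-map f (edge r) = edge (f r)
walk-map f (r ∷ w)  = f r ∷ walk-map f w

-- Arithmetic of path lengths and of the number of vertices used.

m≤m*m : ∀ m → m ≤ m * m
m≤m*m zero    = z≤n
m≤m*m (suc m) = m≤m*n (suc m) (suc m)

-- The witness is the quotient of `a ∸ b` by `c` plus one, so that the inequality is strict even
-- when `c` divides `a ∸ b`.
ceiling-multiple : ∀ a b c .{{_ : NonZero c}} → b ≤ a →
                   ∃[ t ] a < t * c + b × t * c + b ≤ a + c
ceiling-multiple a b c b≤a = suc q , below , above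
  where
  open ≤-Reasoning
  q = (a ∸ b) / c

  below : a < suc q * c + b
  below = begin-strict
    a                              ≡⟨ m∸n+n≡m b≤a ⟨
    a ∸ b + b                      ≡⟨ cong (_+ b) (m≡m%n+[m/n]*n (a ∸ b) c) ⟩
    (a ∸ b) % c + q * c + b        <⟨ +-monoˡ-< b (+-monoˡ-< (q * c) (m%n<n (a ∸ b) c)) ⟩
    c + q * c + b                  ∎

  above : suc q * c + b ≤ a + c
  above = begin
    c + q * c + b      ≤⟨ +-monoˡ-≤ b (+-monoʳ-≤ c (m/n*n≤m (a ∸ b) c)) ⟩
    c + (a ∸ b) + b    ≡⟨ +-assoc c (a ∸ b) b ⟩
    c + (a ∸ b + b)    ≡⟨ cong (c +_) (m∸n+n≡m b≤a) ⟩
    c + a              ≡⟨ +-comm c a ⟩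
    a + c              ∎

module Budget {n d ℓ} .{{_ : NonZero n}} .{{_ : NonZero d}} (d≤n : d ≤ n)
  (ℓ-small : 64 * (n * n * n) * (ℓ * ℓ) ≤ d * d * d * d) where

  open ≤-Reasoning

  -- Since `d ≤ n`, `d⁴` is at most `n³ d`; cancelling `n³` from `ℓ-small` gives `64 ℓ² ≤ d`.
  64ℓ≤d : 64 * ℓ ≤ d
  64ℓ≤d = ≤-trans (*-monoʳ-≤ 64 (m≤m*m ℓ)) (*-cancelˡ-≤ (n * n * n) {{n³≢0}} (begin
    n * n * n * (64 * (ℓ * ℓ))  ≡⟨ rearrange n ℓ ⟩
    64 * (n * n * n) * (ℓ * ℓ)  ≤⟨ ℓ-small ⟩
    d * d * d * d               ≤⟨ *-monoˡ-≤ d (*-mono-≤ (*-mono-≤ d≤n d≤n) d≤n) ⟩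
    n * n * n * d               ∎))
    where
    n³≢0 = m*n≢0 (n * n) n {{m*n≢0 n n}}
    rearrange : ∀ n ℓ → n * n * n * (64 * (ℓ * ℓ)) ≡ 64 * (n * n * n) * (ℓ * ℓ)
    rearrange = solve-∀

  2ℓ≤d : 2 * ℓ ≤ d
  2ℓ≤d = ≤-trans (*-monoˡ-≤ ℓ (m≤m+n 2 62)) 64ℓ≤d

  private
    length-bound : ∃[ T ] 8 * n * n + 8 * n * ℓ < T * (d * d) + 4 * n * d ×
                          T * (d * d) + 4 * n * d ≤ 8 * n * n + 8 * n * ℓ + d * d
    length-bound = ceiling-multiple _ (4 * n * d) (d * d) {{m*n≢0 d d}} (begin
      4 * n * d              ≤⟨ *-mono-≤ (*-monoˡ-≤ n (m≤m+n 4 4)) d≤n ⟩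
      8 * n * n              ≤⟨ m≤m+n _ _ ⟩
      8 * n * n + 8 * n * ℓ  ∎)

  T : ℕ
  T = proj₁ length-bound

  T-large : 8 * n * n + 8 * n * ℓ < T * (d * d) + 4 * n * d
  T-large = proj₁ (proj₂ length-bound)

  T-small : T * (d * d) + 4 * n * d ≤ 8 * n * n + 8 * n * ℓ + d * d
  T-small = proj₂ (proj₂ length-bound)

  -- Multiply by `d²` and insert `T-small`. The leading term `64 n³ ℓ²` can use up all of `d⁴`, so
  -- the lower-order terms need another source: the `4 * n * d` in `T-small`, which times `8 n ℓ²`
  -- saves `32 W` with `W = n² d ℓ²`. By `d ≤ n`, `64ℓ≤d` and `ℓ ≤ ℓ²` those terms total at most
  -- `21 W`.
  budget : 8 * n * (ℓ + ℓ * ℓ * T) + 4 * d * ℓ ≤ d * d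
  budget = *-cancelʳ-≤ _ (d * d) (d * d) {{m*n≢0 d d}}
    (+-cancelʳ-≤ (32 * (n * n * d * (ℓ * ℓ))) _ _ (begin
      (8 * n * (ℓ + ℓ * ℓ * T) + 4 * d * ℓ) * (d * d) + 32 * (n * n * d * (ℓ * ℓ))
        ≡⟨ e₁ n d ℓ T ⟩
      8 * n * (ℓ * ℓ) * (T * (d * d) + 4 * n * d) + (8 * (n * d * d * ℓ) + 4 * (d * d * d * ℓ))
        ≤⟨ +-monoˡ-≤ _ (*-monoʳ-≤ (8 * n * (ℓ * ℓ)) T-small) ⟩
      8 * n * (ℓ * ℓ) * (8 * n * n + 8 * n * ℓ + d * d) + (8 * (n * d * d * ℓ) + 4 * (d * d * d * ℓ))
        ≡⟨ e₂ n d ℓ ⟩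
      64 * (n * n * n) * (ℓ * ℓ) + (n * n * (64 * ℓ) * (ℓ * ℓ) + 8 * (n * d * d * (ℓ * ℓ)) +
        (8 * (n * d * d * ℓ) + 4 * (d * d * d * ℓ)))
        ≤⟨ +-mono-≤ ℓ-small (+-mono-≤ (+-mono-≤
             (*-monoˡ-≤ (ℓ * ℓ) (*-monoʳ-≤ (n * n) 64ℓ≤d))
             (*-monoʳ-≤ 8 (*-monoˡ-≤ (ℓ * ℓ) ndd≤nnd)))
             (+-mono-≤ (*-monoʳ-≤ 8 (*-mono-≤ ndd≤nnd (m≤m*m ℓ)))
                       (*-monoʳ-≤ 4 (*-mono-≤ (*-monoˡ-≤ d (*-mono-≤ d≤n d≤n)) (m≤m*m ℓ))))) ⟩
      d * d * d * d + (W + 8 * W + (8 * W + 4 * W))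
        ≡⟨ e₃ (d * d * d * d) W ⟩
      d * d * d * d + 21 * W
        ≤⟨ +-monoʳ-≤ (d * d * d * d) (*-monoˡ-≤ W (m≤m+n 21 11)) ⟩
      d * d * d * d + 32 * W
        ≡⟨ cong (_+ 32 * W) (*-assoc (d * d) d d) ⟩
      d * d * (d * d) + 32 * W ∎))
    where
    W = n * n * d * (ℓ * ℓ)
    ndd≤nnd : n * d * d ≤ n * n * d
    ndd≤nnd = *-monoˡ-≤ d (*-monoʳ-≤ n d≤n)
    e₁ : ∀ n d ℓ T →
      (8 * n * (ℓ + ℓ * ℓ * T) + 4 * d * ℓ) * (d * d) + 32 * (n * n * d * (ℓ * ℓ)) ≡
      8 * n * (ℓ * ℓ) * (T * (d * d) + 4 * n * d) + (8 * (n * d * d * ℓ) + 4 * (d * d * d * ℓ))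
    e₁ = solve-∀
    e₂ : ∀ n d ℓ →
      8 * n * (ℓ * ℓ) * (8 * n * n + 8 * n * ℓ + d * d) + (8 * (n * d * d * ℓ) + 4 * (d * d * d * ℓ)) ≡
      64 * (n * n * n) * (ℓ * ℓ) + (n * n * (64 * ℓ) * (ℓ * ℓ) + 8 * (n * d * d * (ℓ * ℓ)) +
        (8 * (n * d * d * ℓ) + 4 * (d * d * d * ℓ)))
    e₂ = solve-∀
    e₃ : ∀ q w → q + (w + 8 * w + (8 * w + 4 * w)) ≡ q + 21 * w
    e₃ = solve-∀

theorem2 : ∀ (n d : ℕ) .{{_ : NonZero n}} .{{_ : NonZero d}} →
    (G : Digraph (Fin n)) (edge? : Decidable (Edge G)) →
    d ≤ minOutdegree G edge? →
    ContainsSubdivisionOf G (complete (⌊d²/8n^3/2⌋ d n))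
theorem2 n d G edge? d≤δ =
  linked⇒subdivision G b b-injective f
    (λ i j → proj₁ (linked i j))
    (λ i j → proj₂ (linked i j))
    (λ i j h b∈ → All.lookup (g∉X (combine i j)) b∈ (b∈X h))
    (λ z∈ z∈′ → combine-injective _ _ _ _ (g-disjoint z∈ z∈′))
  where
  ℓ = ⌊d²/8n^3/2⌋ d n

  v₀ : Fin n
  v₀ = fromℕ< (>-nonZero⁻¹ n)

  out≥d : ∀ v → d ≤ ∣ comprehension (edge? v) ∣
  out≥d v = ≤-trans d≤δ (≤-trans
    (All.lookup (min≤xs n _) (∈-map⁺ (outdegree G edge?) (∈-allFin v)))
    (≤-reflexive (length-filter-tabulate (edge? v) id)))

  d≤n : d ≤ n
  d≤n = ≤-trans (out≥d v₀) (∣p∣≤n (comprehension (edge? v₀)))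

  ℓ-small : 64 * (n * n * n) * (ℓ * ℓ) ≤ d * d * d * d
  ℓ-small = begin
    64 * (n * n * n) * (ℓ * ℓ)  ≡⟨ cong₂ _*_ (cong (64 *_) (cube n)) (square ℓ) ⟩
    64 * n ^ 3 * ℓ ^ 2          ≤⟨ proj₁ (⌊d²/8n^3/2⌋-spec d n) ⟩
    d ^ 4                       ≡⟨ fourth d ⟩
    d * d * d * d               ∎
    where
    open ≤-Reasoning
    -- The products ending in `1` are what the powers compute to.
    square : ∀ m → m * m ≡ m * (m * 1)
    square = solve-∀
    cube : ∀ m → m * m * m ≡ m * (m * (m * 1))
    cube = solve-∀
    fourth : ∀ m → m * (m * (m * (m * 1))) ≡ m * m * m * m
    fourth = solve-∀

  open Budget {ℓ = ℓ} d≤n ℓ-small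
  open Core (core edge? out≥d v₀)

  R? : Decidable (Within (Edge G) A)
  R? = within? edge? A

  R⊆A : ∀ {x y} → Within (Edge G) A x y → x ∈ A × y ∈ A
  R⊆A = Within⊆ (Edge G) A

  open DoubleCounting R? A R⊆A

  branches : Σ[ b ∈ (Fin ℓ → Fin n) ] (∀ {i j} → b i ≡ b j → i ≡ j) × (∀ i → b i ∈ popular d ℓ)
  branches = choose (popular d ℓ) ℓ (∣popular∣≥ℓ 2ℓ≤d out≥ nonempty)

  b : Fin ℓ → Fin n
  b = proj₁ branches

  b-injective : ∀ {i j} → b i ≡ b j → i ≡ j
  b-injective = proj₁ (proj₂ branches)

  b-popular : ∀ i → Popular d ℓ (b i)
  b-popular i = ∈-comprehension⁻ (popular? d ℓ) (proj₂ (proj₂ branches) i)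

  -- All branch vertices are forbidden from the outset, including the two ends of the path sought:
  -- only interiors have to avoid `X`.
  X : Subset n
  X = fromList (List.tabulate b)

  b∈X : ∀ i → b i ∈ X
  b∈X i = ∈-fromList⁺ (∈-tabulate⁺ i)

  Linked : Fin ℓ × Fin ℓ → Pred (List (Fin n)) 0ℓ
  Linked (i , j) xs = Walk (Edge G) (b i) xs (b j) × Unique xs

  -- The bound on `Y` is the total ever used: `ℓ` branch vertices and `ℓ * ℓ` interiors of at most
  -- `T` vertices each.
  link : ∀ i j Y → ∣ Y ∣ ≤ ℓ + ℓ * ℓ * T →
         ∃[ xs ] Linked (i , j) xs × All (_∉ Y) xs × length xs ≤ T
  link i j Y ∣Y∣≤ = interior , (walk-map (proj₂ ∘ proj₂) walk , unique) , avoids , short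
    where
    Y-small : 8 * n * ∣ Y ∣ + 4 * d * ℓ ≤ d * d
    Y-small = ≤-trans (+-monoˡ-≤ (4 * d * ℓ) (*-monoʳ-≤ (8 * n) ∣Y∣≤)) budget
    open Search R? A R⊆A {ℓ = ℓ} expand Y Y-small (proj₁ (b-popular i)) (proj₂ (b-popular j))
    open Path (findPath {T} T-large)

  -- All ordered pairs are linked, those with equal entries by closed walks; this makes the index
  -- set `Fin (ℓ * ℓ)`, decoded by `remQuot`.
  system : Σ[ g ∈ (Fin (ℓ * ℓ) → List (Fin n)) ]
    (∀ e → Linked (remQuot ℓ e) (g e)) × (∀ e → All (_∉ X) (g e)) ×
    (∀ {e e′ z} → z List∈.∈ g e → z List∈.∈ g e′ → e ≡ e′)
  system = greedy (ℓ * ℓ) (Linked ∘ remQuot ℓ) (λ e Y _ → link _ _ Y) X id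
    (+-monoˡ-≤ (ℓ * ℓ * T) (≤-trans (∣fromList∣≤length (List.tabulate b))
      (≤-reflexive (length-tabulate b))))

  g = proj₁ system
  g∉X = proj₁ (proj₂ (proj₂ system))

  g-disjoint : ∀ {e e′ z} → z List∈.∈ g e → z List∈.∈ g e′ → e ≡ e′
  g-disjoint = proj₂ (proj₂ (proj₂ system))

  f : Fin ℓ → Fin ℓ → List (Fin n)
  f i j = g (combine i j)

  linked : ∀ i j → Linked (i , j) (f i j)
  linked i j = subst (λ ij → Linked ij (f i j)) (remQuot-combine i j)
    (proj₁ (proj₂ system) (combine i j))
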